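{- Let $\gamma$ be a digital curve (i.e. a digital $0$-curve) in the $3$-dimensional grid cell model. For $i=0,1,2,3$ let $c_i=c_i(\gamma)$ be the number of $i$-cells of $\gamma$, and let $g_0=g_0(\gamma)$ be the number of $0$-gaps of $\gamma$. Then \[ g_0 = \sum_{i=0}^{3} (-1)^{i+1}\, 2^i\, c_i , \] that is, $g_0=-c_0+2c_1-4c_2+8c_3$.
   Context: Grid cell model in dimension 3: for $x\in\mathbb{Z}^3$ and $\theta\in\{ -1,0,1\}^3$, the cell $(x,\theta)$ is the subset $\prod_{j=1}^3 I_j$ of $\mathbb{R}^3$, where $I_j=[x_j-\frac12,x_j+\frac12]$ if $\theta_j=0$ and $I_j=\{x_j+\frac12\theta_j\}$ if $\theta_j\neq 0$. Its dimension is the number of $j$ with $\theta_j=0$; a cell of dimension $i$ is an $i$-cell (cells are identified as subsets of $\mathbb{R}^3$, so the same cell may have several representations $(x,\theta)$). A $3$-cell is called a voxel. A digital object $D$ is a finite set of voxels. The $i$-cells of $D$ are the $i$-cells contained in at least one voxel of $D$; their number is $c_i(D)$ (so $c_3(D)=|D|$). Adjacency: two distinct voxels $v_1,v_2$ are $i$-adjacent ($i=0,1,2$) if $v_1\cap v_2$ contains an $i$-cell; they are strictly $i$-adjacent if $v_1\cap v_2$ is itself an $i$-cell. Digital curve: a digital object $\gamma$ such that (1) for every $v\in\gamma$ the number of voxels of $\gamma$ that are $0$-adjacent to $v$ is at least $1$ and at most $2$; (2) for every $v\in\gamma$, if $v_1,v_2$ are two distinct voxels of $\gamma$ both $0$-adjacent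 to $v$, then $v_1$ and $v_2$ are not $0$-adjacent to each other. Gaps: for a $0$-cell $e$, the $0$-block $B_0(e)$ is the set of the $8$ voxels containing $e$. A digital object $D$ has a $0$-gap over the $0$-cell $e$ if $D\cap B_0(e)$ is a $0$-tandem over $e$, i.e. $D\cap B_0(e)=\{v_1,v_2\}$ with $v_1,v_2$ strictly $0$-adjacent and $v_1\cap v_2=e$. The number $g_0(D)$ is the number of $0$-cells $e$ over which $D$ has a $0$-gap. -}

module Defs where

open import Data.Fin.Base using (Fin)
open import Data.Integer.Base using (ℤ)
open import Data.List.Base using (List; length)
open import Data.List.Relation.Unary.All using (All)
import Data.List.Membership.Setoid as Membership
import Data.List.Relation.Unary.Unique.Setoid as Uniqueness
open import Data.Nat.Base as ℕ using (ℕ)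
open import Data.Product.Base using (∃; ∃-syntax; _×_)
open import Data.Rational.Base using (ℚ; _<_; _+_; _-_; ½)
open import Data.Rational.Literals using (fromℤ)
open import Data.Sum.Base using (_⊎_)
open import Data.Vec.Base using (Vec; count; lookup)
open import Function.Bundles using (_⇔_)
open import Level using (0ℓ; suc)
open import Relation.Binary.Bundles using (Setoid)
open import Relation.Binary.Definitions using (DecidableEquality)
import Relation.Binary.Construct.On as On
open import Relation.Binary.PropositionalEquality using (_≡_; refl)
open import Relation.Nullary using (¬_; yes; no)
open import Relation.Unary using (Pred; _∩_; _⊆_; _≐_)
open import Relation.Unary.Relation.Binary.Equality using (≐-setoid)

-- Dedekind reals: L q means q < x, and U q means x < q.
record ℝ : Set₁ where
  field
    L U         : Pred ℚ 0ℓ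
    L-inhabited : ∃ L
    U-inhabited : ∃ U
    L-rounded   : ∀ q → L q ⇔ (∃[ r ] q < r × L r)
    U-rounded   : ∀ q → U q ⇔ (∃[ r ] r < q × U r)
    disjoint    : ∀ q → ¬ (L q × U q)
    located     : ∀ {q r} → q < r → L q ⊎ U r

-- The closed interval [a , b] of reals; the conjuncts say a ≤ x and x ≤ b.
[_⋯_] : ℚ → ℚ → Pred ℝ 0ℓ
[ a ⋯ b ] x = ¬ ℝ.U x a × ¬ ℝ.L x b

Point : Set₁
Point = Vec ℝ 3

data Offset : Set where
  -𝟏 𝟎 +𝟏 : Offset

_≟ᴼ_ : DecidableEquality Offset
-𝟏 ≟ᴼ -𝟏 = yes refl
-𝟏 ≟ᴼ 𝟎  = no λ ()
-𝟏 ≟ᴼ +𝟏 = no λ ()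
𝟎  ≟ᴼ -𝟏 = no λ ()
𝟎  ≟ᴼ 𝟎  = yes refl
𝟎  ≟ᴼ +𝟏 = no λ ()
+𝟏 ≟ᴼ -𝟏 = no λ ()
+𝟏 ≟ᴼ 𝟎  = no λ ()
+𝟏 ≟ᴼ +𝟏 = yes refl

-- A degenerate interval [ a ⋯ a ] is the singleton {a}.
interval : ℤ → Offset → Pred ℝ 0ℓ
interval x 𝟎  = [ fromℤ x - ½ ⋯ fromℤ x + ½ ]
interval x -𝟏 = [ fromℤ x - ½ ⋯ fromℤ x - ½ ]
interval x +𝟏 = [ fromℤ x + ½ ⋯ fromℤ x + ½ ]

record Cell : Set where
  constructor cell
  field
    x : Vec ℤ 3
    θ : Vec Offset 3

⟦_⟧ : Cell → Pred Point 0ℓ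
⟦ cell x θ ⟧ p = ∀ (j : Fin 3) → interval (lookup x j) (lookup θ j) (lookup p j)

dim : Cell → ℕ
dim e = count (_≟ᴼ 𝟎) (Cell.θ e)

-- A cell can have several representations, so cells are compared as subsets
-- of ℝ³; membership in lists and counting are taken up to this equality.
cellSetoid : Setoid 0ℓ (suc 0ℓ)
cellSetoid = On.setoid (≐-setoid Point 0ℓ) ⟦_⟧

open Setoid cellSetoid public using (_≈_; _≉_)
open Membership cellSetoid public using (_∈_)
open Uniqueness cellSetoid public using (Unique)

HasCardinality : ∀ {ℓ} → Pred Cell ℓ → ℕ → Set _
HasCardinality P n = ∃[ es ] Unique es × P ≐ (_∈ es) × length es ≡ n

IsCell : ℕ → Pred Cell 0ℓ
IsCell i e = dim e ≡ i

IsVoxel : Pred Cell 0ℓ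
IsVoxel = IsCell 3

-- The finite set underlying the list; repetitions are immaterial.
record DigitalObject : Set where
  field
    elements : List Cell
    voxels   : All IsVoxel elements

Voxels : DigitalObject → Pred Cell (suc 0ℓ)
Voxels D v = v ∈ DigitalObject.elements D

CellsOf : ℕ → DigitalObject → Pred Cell (suc 0ℓ)
CellsOf i D e = IsCell i e × ∃[ v ] Voxels D v × ⟦ e ⟧ ⊆ ⟦ v ⟧

-- Adjacency and strict adjacency are only ever applied to voxels.
Adjacent : ℕ → Cell → Cell → Set₁
Adjacent i v₁ v₂ = v₁ ≉ v₂ × ∃[ e ] IsCell i e × ⟦ e ⟧ ⊆ ⟦ v₁ ⟧ ∩ ⟦ v₂ ⟧

StrictlyAdjacent : ℕ → Cell → Cell → Set₁
StrictlyAdjacent i v₁ v₂ = v₁ ≉ v₂ × ∃[ e ] IsCell i e × ⟦ v₁ ⟧ ∩ ⟦ v₂ ⟧ ≐ ⟦ e ⟧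

Neighbours : DigitalObject → Cell → Pred Cell (suc 0ℓ)
Neighbours D v w = Voxels D w × Adjacent 0 w v

record IsDigitalCurve (γ : DigitalObject) : Set₁ where
  field
    neighbours : ∀ v → Voxels γ v →
      ∃[ n ] HasCardinality (Neighbours γ v) n × 1 ℕ.≤ n × n ℕ.≤ 2
    separated : ∀ v v₁ v₂ → Voxels γ v → Neighbours γ v v₁ → Neighbours γ v v₂ →
      v₁ ≉ v₂ → ¬ Adjacent 0 v₁ v₂

Block₀ : Cell → Pred Cell (suc 0ℓ)
Block₀ e v = IsVoxel v × ⟦ e ⟧ ⊆ ⟦ v ⟧

｛_,_｝ : Cell → Cell → Pred Cell (suc 0ℓ)
｛ v₁ , v₂ ｝ v = v ≈ v₁ ⊎ v ≈ v₂

IsTandem₀ : Cell → Pred Cell (suc 0ℓ) → Set₁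
IsTandem₀ e P = ∃[ v₁ ] ∃[ v₂ ]
  P ≐ ｛ v₁ , v₂ ｝ × StrictlyAdjacent 0 v₁ v₂ × ⟦ v₁ ⟧ ∩ ⟦ v₂ ⟧ ≐ ⟦ e ⟧

Gaps₀ : DigitalObject → Pred Cell (suc 0ℓ)
Gaps₀ D e = IsCell 0 e × IsTandem₀ e (Voxels D ∩ Block₀ e)

{-# OPTIONS --safe #-}

-- Weight a cell e by w(e) = (−2)^dim e, so that the right-hand side is −Σ w(e) over
-- the cells of γ. The weight is multiplicative over coordinates and a unit segment
-- with its two endpoints has total weight 1 − 2 + 1 = 0. Hence the total weight
-- χ(u, v) of the common faces of two voxels u and v is 1 if u ∩ v is a single point,
-- and 0 otherwise. Since the voxels containing a common cell are pairwise 0-adjacent,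
-- every cell e of γ lies in n(e) ∈ {1, 2} voxels, and 2 = 3 n(e) − n(e)². Summing
-- against w gives 2 Σ w(e) = 3 Σ χ(v, v) − Σ χ(u, v) = −Σ χ(u, v), and the last sum
-- counts every gap twice.

module Submission where

open import Data.Bool.Base using (if_then_else_)
open import Data.Empty using (⊥; ⊥-elim)
open import Data.Fin using (#_)
open import Data.Fin.Base using (Fin; zero; suc; toℕ; fromℕ<)
open import Data.Fin.Properties using (toℕ-fromℕ<; toℕ-injective)
open import Data.Integer.Base as ℤ
  using (ℤ; +_; -[1+_]; 0ℤ; 1ℤ; -1ℤ; _+_; _*_; _^_; -_) renaming (suc to sucℤ; pred to predℤ)
open import Data.Integer.Properties as ℤₚ using (_≟_; +-0-monoid)
open import Data.Integer.Tactic.RingSolver using (solve-∀)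
open import Data.List.Base
  using (List; []; _∷_; _++_; map; length; concat; tabulate; cartesianProductWith)
open import Data.List.Membership.Propositional using (_∉_; find; lose) renaming (_∈_ to _∈ₗ_)
open import Data.List.Membership.Propositional.Properties
  using (∈-map⁺; ∈-map⁻; ∈-concat⁺′; ∈-concat⁻′; ∈-tabulate⁺; ∈-tabulate⁻; ∈-∃++;
         ∈-cartesianProductWith⁺; ∈-cartesianProductWith⁻)
open import Data.List.Properties using (length-map)
open import Data.List.Relation.Binary.Permutation.Propositional as ↭ using (_↭_; ↭-sym)
open import Data.List.Relation.Binary.Permutation.Propositional.Properties using (shift; ∈-resp-↭)
open import Data.List.Relation.Binary.Permutation.Setoid.Properties using (Unique-resp-↭)
open import Data.List.Relation.Unary.All as All using ([]; _∷_)
import Data.List.Relation.Unary.All.Properties as Allₚ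
open import Data.List.Relation.Unary.AllPairs as AllPairs using ([]; _∷_)
import Data.List.Relation.Unary.AllPairs.Properties as AllPairsₚ
open import Data.List.Relation.Unary.Any as Any using (here; there; any?)
import Data.List.Relation.Unary.Any.Properties as Anyₚ
open import Data.List.Relation.Unary.Unique.Propositional using () renaming (Unique to Uniqueₗ)
open import Data.List.Relation.Unary.Unique.Propositional.Properties
  using (cartesianProductWith⁺; concat⁺)
open import Data.Nat.Base as ℕ using (ℕ; suc)
import Data.Nat.Properties as ℕₚ
open import Data.Product.Base using (∃; ∃-syntax; _×_; _,_; proj₁; proj₂)
open import Data.Rational.Base as ℚ using (ℚ; ½; *<*)
open import Data.Rational.Literals using (fromℤ)
import Data.Rational.Properties as ℚₚ
open import Data.Sum.Base as Sum using (_⊎_; inj₁; inj₂; swap)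
open import Data.Vec.Base as Vec using (Vec; []; _∷_; count; lookup; zipWith)
open import Data.Vec.Properties as Vecₚ using (∷-injective; lookup-map; lookup-zipWith)
open import Data.Vec.Relation.Binary.Pointwise.Extensional using (ext; extensional⇒inductive)
open import Data.Vec.Relation.Binary.Pointwise.Inductive as Pointwise using (Pointwise; []; _∷_)
open import Function.Base using (_∘_; id; case_of_)
open import Function.Bundles using (Equivalence; mk⇔)
open import Level using (Level; 0ℓ)
open import Relation.Binary.Bundles using (Setoid)
open import Relation.Binary.Definitions using (tri<; tri≈; tri>)
open import Relation.Binary.PropositionalEquality
  using (_≡_; _≢_; refl; sym; trans; cong; cong₂; subst; subst₂; setoid; module ≡-Reasoning)
open import Relation.Nullary
  using (¬_; Dec; yes; no; does; contradiction; ¬?; _×-dec_; _⊎-dec_)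
open import Relation.Nullary.Decidable using (dec-true; dec-false)
open import Relation.Unary using (Pred; _∩_; _⊆_; _≐_)
open import Algebra.Properties.Monoid.Sum +-0-monoid using (sum-syntax)
open import Defs

-- Sums over lists

private variable
  a : Level
  A B C : Set a

∑ : List A → (A → ℤ) → ℤ
∑ []       f = 0ℤ
∑ (x ∷ xs) f = f x + ∑ xs f

∑-cong : ∀ (xs : List A) {f g : A → ℤ} → (∀ {x} → x ∈ₗ xs → f x ≡ g x) → ∑ xs f ≡ ∑ xs g
∑-cong []       eq = refl
∑-cong (x ∷ xs) eq = cong₂ _+_ (eq (here refl)) (∑-cong xs (eq ∘ there))

∑-zero : ∀ (xs : List A) → ∑ xs (λ _ → 0ℤ) ≡ 0ℤ
∑-zero []       = refl
∑-zero (x ∷ xs) = trans (ℤₚ.+-identityˡ _) (∑-zero xs)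

∑-const : ∀ (xs : List A) k → ∑ xs (λ _ → k) ≡ k * + length xs
∑-const []       k = sym (ℤₚ.*-zeroʳ k)
∑-const (x ∷ xs) k = trans (cong (_+_ k) (∑-const xs k)) (sym (ℤₚ.*-suc k (+ length xs)))

∑-+ : ∀ (xs : List A) f g → ∑ xs (λ x → f x + g x) ≡ ∑ xs f + ∑ xs g
∑-+ []       f g = refl
∑-+ (x ∷ xs) f g = trans (cong (_+_ (f x + g x)) (∑-+ xs f g)) (lemma (f x) (g x) _ _)
  where
  lemma : ∀ p q r s → (p + q) + (r + s) ≡ (p + r) + (q + s)
  lemma = solve-∀

*-distribˡ-∑ : ∀ (xs : List A) k f → k * ∑ xs f ≡ ∑ xs (λ x → k * f x)
*-distribˡ-∑ []       k f = ℤₚ.*-zeroʳ k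
*-distribˡ-∑ (x ∷ xs) k f =
  trans (ℤₚ.*-distribˡ-+ k (f x) _) (cong (_+_ (k * f x)) (*-distribˡ-∑ xs k f))

*-distribʳ-∑ : ∀ (xs : List A) k f → ∑ xs f * k ≡ ∑ xs (λ x → f x * k)
*-distribʳ-∑ xs k f = trans (ℤₚ.*-comm _ k)
  (trans (*-distribˡ-∑ xs k f) (∑-cong xs (λ {x} _ → ℤₚ.*-comm k (f x))))

∑-swap : ∀ (xs : List A) (ys : List B) (f : A → B → ℤ) →
  ∑ xs (λ x → ∑ ys (f x)) ≡ ∑ ys (λ y → ∑ xs (λ x → f x y))
∑-swap []       ys f = sym (∑-zero ys)
∑-swap (x ∷ xs) ys f =
  trans (cong (_+_ (∑ ys (f x))) (∑-swap xs ys f)) (sym (∑-+ ys (f x) _))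

∑-++ : ∀ (xs ys : List A) f → ∑ (xs ++ ys) f ≡ ∑ xs f + ∑ ys f
∑-++ []       ys f = sym (ℤₚ.+-identityˡ _)
∑-++ (x ∷ xs) ys f = trans (cong (_+_ (f x)) (∑-++ xs ys f)) (sym (ℤₚ.+-assoc (f x) _ _))

∑-map : ∀ (g : A → B) xs f → ∑ (map g xs) f ≡ ∑ xs (f ∘ g)
∑-map g []       f = refl
∑-map g (x ∷ xs) f = cong (_+_ (f (g x))) (∑-map g xs f)

∑-↭ : ∀ {xs ys : List A} f → xs ↭ ys → ∑ xs f ≡ ∑ ys f
∑-↭ f ↭.refl         = refl
∑-↭ f (↭.prep x p)   = cong (_+_ (f x)) (∑-↭ f p)
∑-↭ f (↭.swap x y p) = trans (cong (λ s → f x + (f y + s)) (∑-↭ f p)) (lemma (f x) (f y) _)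
  where
  lemma : ∀ p q r → p + (q + r) ≡ q + (p + r)
  lemma = solve-∀
∑-↭ f (↭.trans p q)  = trans (∑-↭ f p) (∑-↭ f q)

-- Induction on `ys`: a permutation brings each of its entries to the front of `xs`, and uniqueness
-- keeps that entry out of the remainder. What is left at the end contributes only zeros. This
-- collapses sums containing an indicator.
∑-support : ∀ {xs ys : List A} (f : A → ℤ) → Uniqueₗ xs → Uniqueₗ ys →
  (∀ {x} → x ∈ₗ ys → x ∈ₗ xs) → (∀ {x} → x ∈ₗ xs → x ∉ ys → f x ≡ 0ℤ) → ∑ xs f ≡ ∑ ys f
∑-support {xs = xs} {[]} f xs! _ ys⊆xs f≡0 =
  trans (∑-cong xs (λ x∈xs → f≡0 x∈xs λ ())) (∑-zero xs)
∑-support {xs = xs} {y ∷ ys} f xs! (y∉ys ∷ ys!) ys⊆xs f≡0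
  with ps , qs , refl ← ∈-∃++ (ys⊆xs (here refl))
  with xs↭ ← shift y ps qs
  with y∉ ∷ rest! ← Unique-resp-↭ (setoid _) (↭.↭⇒↭ₛ xs↭) xs! =
  trans (∑-↭ f xs↭) (cong (_+_ (f y)) (∑-support f rest! ys! ys⊆rest rest≡0))
  where
  ys⊆rest : ∀ {x} → x ∈ₗ ys → x ∈ₗ ps ++ qs
  ys⊆rest x∈ys with ∈-resp-↭ xs↭ (ys⊆xs (there x∈ys))
  ... | here refl = contradiction x∈ys (Allₚ.All¬⇒¬Any y∉ys)
  ... | there x∈  = x∈

  rest≡0 : ∀ {x} → x ∈ₗ ps ++ qs → x ∉ ys → f x ≡ 0ℤ
  rest≡0 x∈ x∉ys = f≡0 (∈-resp-↭ (↭-sym xs↭) (there x∈)) λ where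
    (here refl)  → Allₚ.All¬⇒¬Any y∉ x∈
    (there x∈ys) → x∉ys x∈ys

-- Distributivity; it turns a sum over the faces of a box into a product over coordinates.
∑-cartesianProductWith : ∀ (h : A → B → C) (F : C → ℤ) (f : A → ℤ) (g : B → ℤ) →
  (∀ x y → F (h x y) ≡ f x * g y) →
  ∀ xs ys → ∑ (cartesianProductWith h xs ys) F ≡ ∑ xs f * ∑ ys g
∑-cartesianProductWith h F f g eq []       ys = refl
∑-cartesianProductWith h F f g eq (x ∷ xs) ys = begin
  ∑ (map (h x) ys ++ cartesianProductWith h xs ys) F
    ≡⟨ ∑-++ (map (h x) ys) _ F ⟩
  ∑ (map (h x) ys) F + ∑ (cartesianProductWith h xs ys) F
    ≡⟨ cong₂ _+_ (trans (∑-map (h x) ys F) (∑-cong ys (λ {y} _ → eq x y)))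
                 (∑-cartesianProductWith h F f g eq xs ys) ⟩
  ∑ ys (λ y → f x * g y) + ∑ xs f * ∑ ys g
    ≡⟨ cong (_+ ∑ xs f * ∑ ys g) (*-distribˡ-∑ ys (f x) g) ⟨
  f x * ∑ ys g + ∑ xs f * ∑ ys g
    ≡⟨ ℤₚ.*-distribʳ-+ (∑ ys g) (f x) (∑ xs f) ⟨
  (f x + ∑ xs f) * ∑ ys g ∎
  where open ≡-Reasoning

𝟙 : ∀ {P : Set} → Dec P → ℤ
𝟙 P? = if does P? then 1ℤ else 0ℤ

𝟙-true : ∀ {P : Set} (P? : Dec P) → P → 𝟙 P? ≡ 1ℤ
𝟙-true P? p rewrite dec-true P? p = refl

𝟙-false : ∀ {P : Set} (P? : Dec P) → ¬ P → 𝟙 P? ≡ 0ℤ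
𝟙-false P? ¬p rewrite dec-false P? ¬p = refl

-- Boxes

-- The coordinates are shifted by ½: pt a is the point a − ½, and seg a is the
-- unit interval with centre a.
data Interval : Set where
  pt seg : ℤ → Interval

-- Inclusion of intervals as subsets of the line. Because of the shift by ½, the end points of
-- `seg x` are `pt x` and `pt (sucℤ x)`.
_⊑_ : Interval → Interval → Set
pt a  ⊑ pt b  = a ≡ b
pt a  ⊑ seg x = a ≡ x ⊎ a ≡ sucℤ x
seg a ⊑ pt b  = ⊥
seg a ⊑ seg x = a ≡ x

_⊑?_ : ∀ k x → Dec (k ⊑ seg x)
pt a  ⊑? x = a ≟ x ⊎-dec a ≟ sucℤ x
seg a ⊑? x = a ≟ x

Box : ℕ → Set
Box = Vec Interval

-- A voxel is encoded by the integer vector of its centre, so no side condition on its dimension has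
-- to be carried along.
_⊑ᵥ_ : ∀ {n} → Box n → Vec ℤ n → Set
_⊑ᵥ_ = Pointwise (λ k x → k ⊑ seg x)

_⊑ᵥ?_ : ∀ {n} (e : Box n) v → Dec (e ⊑ᵥ v)
_⊑ᵥ?_ = Pointwise.decidable _⊑?_

δ : ∀ {n} → Box n → Vec ℤ n → ℤ
δ e v = 𝟙 (e ⊑ᵥ? v)

δ-∷ : ∀ {n} k x (e : Box n) v → δ (k ∷ e) (x ∷ v) ≡ 𝟙 (k ⊑? x) * δ e v
δ-∷ k x e v with k ⊑? x | e ⊑ᵥ? v
... | yes _ | yes _ = refl
... | yes _ | no _  = refl
... | no _  | yes _ = refl
... | no _  | no _  = refl

δ-idem : ∀ {n} (e : Box n) v → δ e v * δ e v ≡ δ e v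
δ-idem e v with e ⊑ᵥ? v
... | yes _ = refl
... | no _  = refl

-- `-[1+ 1 ]` is the integer -2.
weight₁ : Interval → ℤ
weight₁ (pt _)  = 1ℤ
weight₁ (seg _) = -[1+ 1 ]

weight : ∀ {n} → Box n → ℤ
weight []      = 1ℤ
weight (k ∷ e) = weight₁ k * weight e

sides : ℤ → List Interval
sides x = pt x ∷ seg x ∷ pt (sucℤ x) ∷ []

faces : ∀ {n} → Vec ℤ n → List (Box n)
faces []      = [] ∷ []
faces (x ∷ v) = cartesianProductWith _∷_ (sides x) (faces v)

sides-complete : ∀ k {x} → k ⊑ seg x → k ∈ₗ sides x
sides-complete (pt a)  (inj₁ refl) = here refl
sides-complete (pt a)  (inj₂ refl) = there (there (here refl))
sides-complete (seg a) refl        = there (here refl)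

sides-sound : ∀ {k x} → k ∈ₗ sides x → k ⊑ seg x
sides-sound (here refl)                 = inj₁ refl
sides-sound (there (here refl))         = refl
sides-sound (there (there (here refl))) = inj₂ refl

faces-complete : ∀ {n} {e : Box n} {v} → e ⊑ᵥ v → e ∈ₗ faces v
faces-complete []                 = here refl
faces-complete (_∷_ {x = k} k⊑ e⊑) =
  ∈-cartesianProductWith⁺ _∷_ (sides-complete k k⊑) (faces-complete e⊑)

faces-sound : ∀ {n} {e : Box n} v → e ∈ₗ faces v → e ⊑ᵥ v
faces-sound []      (here refl) = []
faces-sound (x ∷ v) e∈
  with _ , _ , k∈ , f∈ , refl ← ∈-cartesianProductWith⁻ _∷_ (sides x) (faces v) e∈ =
  sides-sound k∈ ∷ faces-sound v f∈

pt-injective : ∀ {a b} → pt a ≡ pt b → a ≡ b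
pt-injective refl = refl

sides-unique : ∀ x → Uniqueₗ (sides x)
sides-unique x =
  ((λ ()) ∷ (ℤₚ.i≢suc[i] ∘ pt-injective) ∷ []) ∷ ((λ ()) ∷ []) ∷ [] ∷ []

faces-unique : ∀ {n} (v : Vec ℤ n) → Uniqueₗ (faces v)
faces-unique []      = [] ∷ []
faces-unique (x ∷ v) = cartesianProductWith⁺ _∷_ ∷-injective (sides-unique x) (faces-unique v)

-- Meet₁ x y m: the unit intervals with centres x and y intersect in the point m − ½.
Meet₁ : ℤ → ℤ → ℤ → Set
Meet₁ x y m = m ≡ x × x ≡ sucℤ y ⊎ m ≡ y × y ≡ sucℤ x

-- In dimension 3 this is strict 0-adjacency: the centres differ by exactly 1 in every coordinate,
-- and the third index records the common vertex.
data Meet : ∀ {n} → Vec ℤ n → Vec ℤ n → Vec ℤ n → Set where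
  []  : Meet [] [] []
  _∷_ : ∀ {n x y m} {u v p : Vec ℤ n} → Meet₁ x y m → Meet u v p → Meet (x ∷ u) (y ∷ v) (m ∷ p)

meet-sym : ∀ {n} {u v p : Vec ℤ n} → Meet u v p → Meet v u p
meet-sym []      = []
meet-sym (h ∷ t) = swap h ∷ meet-sym t

meet-⊑ : ∀ {n} {u v p : Vec ℤ n} → Meet u v p → Vec.map pt p ⊑ᵥ u
meet-⊑ []                             = []
meet-⊑ (inj₁ (m≡x , _)        ∷ t) = inj₁ m≡x ∷ meet-⊑ t
meet-⊑ (inj₂ (refl , y≡1+x) ∷ t) = inj₂ y≡1+x ∷ meet-⊑ t

i≢2+i : ∀ i → i ≢ sucℤ (sucℤ i)
i≢2+i i eq = ℤₚ.<⇒≢ (ℤₚ.<-trans (ℤₚ.suc[i]≤j⇒i<j ℤₚ.≤-refl) (ℤₚ.suc[i]≤j⇒i<j ℤₚ.≤-refl)) eq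

-- Consecutive unit intervals share one end point; any other coincidence would make an integer equal
-- to its successor or to its second successor.
meet₁-unique : ∀ k {x y m} → Meet₁ x y m → k ⊑ seg x → k ⊑ seg y → k ≡ pt m
meet₁-unique (pt a)  (inj₁ (refl , _))    (inj₁ refl) _           = refl
meet₁-unique (pt a)  (inj₁ (refl , refl)) (inj₂ refl) (inj₁ eq)   = ⊥-elim (i≢2+i _ (sym eq))
meet₁-unique (pt a)  (inj₁ (refl , refl)) (inj₂ refl) (inj₂ eq)   = cong pt eq
meet₁-unique (pt a)  (inj₂ (refl , _))    _           (inj₁ refl) = refl
meet₁-unique (pt a)  (inj₂ (refl , refl)) (inj₁ eq)   (inj₂ refl) = ⊥-elim (i≢2+i _ (sym eq))
meet₁-unique (pt a)  (inj₂ (refl , refl)) (inj₂ eq)   (inj₂ refl) = cong pt eq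
meet₁-unique (seg a) (inj₁ (refl , a≡1+y)) refl       refl        = ⊥-elim (ℤₚ.i≢suc[i] a≡1+y)
meet₁-unique (seg a) (inj₂ (refl , a≡1+x)) refl       refl        = ⊥-elim (ℤₚ.i≢suc[i] a≡1+x)

meet-unique : ∀ {n} {e : Box n} {u v p} → Meet u v p → e ⊑ᵥ u → e ⊑ᵥ v → e ≡ Vec.map pt p
meet-unique {e = []}    []      []       []       = refl
meet-unique {e = k ∷ _} (h ∷ t) (p ∷ ps) (q ∷ qs) =
  cong₂ _∷_ (meet₁-unique k h p q) (meet-unique t ps qs)

suc-injective : ∀ i j → sucℤ i ≡ sucℤ j → i ≡ j
suc-injective i j eq = trans (sym (ℤₚ.pred-suc i)) (trans (cong predℤ eq) (ℤₚ.pred-suc j))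

meet₁⁺ : ∀ {x y m} → pt m ⊑ seg x → pt m ⊑ seg y → x ≢ y → Meet₁ x y m
meet₁⁺ (inj₁ m≡x)   (inj₁ m≡y)   x≢y = contradiction (trans (sym m≡x) m≡y) x≢y
meet₁⁺ (inj₁ m≡x)   (inj₂ m≡1+y) x≢y = inj₁ (m≡x , trans (sym m≡x) m≡1+y)
meet₁⁺ (inj₂ m≡1+x) (inj₁ m≡y)   x≢y = inj₂ (m≡y , trans (sym m≡y) m≡1+x)
meet₁⁺ (inj₂ m≡1+x) (inj₂ m≡1+y) x≢y =
  contradiction (suc-injective _ _ (trans (sym m≡1+x) m≡1+y)) x≢y

-- If two voxels agree in some coordinate, then their intersection also contains a
-- box that is a segment in that direction.
meet⁺ : ∀ {n} {u v : Vec ℤ n} p → Vec.map pt p ⊑ᵥ u → Vec.map pt p ⊑ᵥ v →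
  (∀ {f} → f ⊑ᵥ u → f ⊑ᵥ v → f ≡ Vec.map pt p) → Meet u v p
meet⁺ []      []         []         only = []
meet⁺ (m ∷ p) (h₁ ∷ p⊑u) (h₂ ∷ p⊑v) only =
  meet₁⁺ h₁ h₂ (λ x≡y → seg≢pt (proj₁ (∷-injective (only (refl ∷ p⊑u) (x≡y ∷ p⊑v)))))
  ∷ meet⁺ p p⊑u p⊑v (λ f⊑u f⊑v → proj₂ (∷-injective (only (h₁ ∷ f⊑u) (h₂ ∷ f⊑v))))
  where
  seg≢pt : ∀ {a b} → seg a ≢ pt b
  seg≢pt ()

-- Weighted count of the common faces of two voxels

χ₁ : ℤ → ℤ → ℤ
χ₁ x y = ∑ (sides x) (λ k → weight₁ k * 𝟙 (k ⊑? y))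

χ : ∀ {n} → Vec ℤ n → Vec ℤ n → ℤ
χ u v = ∑ (faces u) (λ e → weight e * δ e v)

-- Both the weight and the incidence factor over coordinates, and `faces` is a product of `sides`.
χ-∷ : ∀ {n} x y (u v : Vec ℤ n) → χ (x ∷ u) (y ∷ v) ≡ χ₁ x y * χ u v
χ-∷ x y u v = ∑-cartesianProductWith _∷_ (λ e → weight e * δ e (y ∷ v))
  (λ k → weight₁ k * 𝟙 (k ⊑? y)) (λ e → weight e * δ e v)
  (λ k e → trans (cong (weight₁ k * weight e *_) (δ-∷ k y e v))
                 (lemma (weight₁ k) (weight e) (𝟙 (k ⊑? y)) (δ e v)))
  (sides x) (faces u)
  where
  lemma : ∀ p q r s → (p * q) * (r * s) ≡ (p * r) * (q * s)
  lemma = solve-∀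

-- The sum over the three sides with the incidences left as parameters, so that each position of `y`
-- relative to `x` only requires three indicator values.
χ₁-by : ∀ x y {a b c} → 𝟙 (pt x ⊑? y) ≡ a → 𝟙 (seg x ⊑? y) ≡ b → 𝟙 (pt (sucℤ x) ⊑? y) ≡ c →
  χ₁ x y ≡ 1ℤ * a + (-[1+ 1 ] * b + (1ℤ * c + 0ℤ))
χ₁-by x y refl refl refl = refl

-- All three sides count: 1 - 2 + 1 = 0.
χ₁-same : ∀ x → χ₁ x x ≡ 0ℤ
χ₁-same x = χ₁-by x x (𝟙-true (pt x ⊑? x) (inj₁ refl)) (𝟙-true (seg x ⊑? x) refl)
                  (𝟙-true (pt (sucℤ x) ⊑? x) (inj₂ refl))

-- Only the shared end point contributes, with weight 1.
χ₁-meet : ∀ {x y m} → Meet₁ x y m → χ₁ x y ≡ 1ℤ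
χ₁-meet {x} {y} (inj₁ (refl , refl)) =
  χ₁-by x y (𝟙-true (pt x ⊑? y) (inj₂ refl)) (𝟙-false (seg x ⊑? y) (ℤₚ.i≢suc[i] ∘ sym))
        (𝟙-false (pt (sucℤ x) ⊑? y)
          λ { (inj₁ eq) → i≢2+i y (sym eq) ; (inj₂ eq) → ℤₚ.i≢suc[i] (sym (suc-injective x y eq)) })
χ₁-meet {x} {y} (inj₂ (refl , refl)) =
  χ₁-by x y (𝟙-false (pt x ⊑? y) λ { (inj₁ eq) → ℤₚ.i≢suc[i] eq ; (inj₂ eq) → i≢2+i x eq })
        (𝟙-false (seg x ⊑? y) ℤₚ.i≢suc[i])
        (𝟙-true (pt (sucℤ x) ⊑? y) (inj₁ refl))

-- The centres are consecutive, equal, or further apart. Equal centres give 1 - 2 + 1, and distant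
-- ones have no side in common.
χ₁-dichotomy : ∀ x y → χ₁ x y ≡ 0ℤ ⊎ ∃ (Meet₁ x y)
χ₁-dichotomy x y = dichotomy (x ≟ sucℤ y) (y ≟ sucℤ x) (x ≟ y)
  where
  dichotomy : Dec (x ≡ sucℤ y) → Dec (y ≡ sucℤ x) → Dec (x ≡ y) → χ₁ x y ≡ 0ℤ ⊎ ∃ (Meet₁ x y)
  dichotomy (yes x≡1+y) _           _          = inj₂ (x , inj₁ (refl , x≡1+y))
  dichotomy (no _)      (yes y≡1+x) _          = inj₂ (y , inj₂ (refl , y≡1+x))
  dichotomy (no _)      (no _)      (yes refl) = inj₁ (χ₁-same x)
  dichotomy (no x≢1+y)  (no y≢1+x)  (no x≢y)   = inj₁
    (χ₁-by x y (𝟙-false (pt x ⊑? y) λ { (inj₁ eq) → x≢y eq ; (inj₂ eq) → x≢1+y eq })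
           (𝟙-false (seg x ⊑? y) x≢y)
           (𝟙-false (pt (sucℤ x) ⊑? y)
             λ { (inj₁ eq) → y≢1+x (sym eq) ; (inj₂ eq) → x≢y (suc-injective x y eq) }))

-- The factor of the first coordinate vanishes. In dimension 0 the value would be the empty product
-- 1, hence the length `suc n`.
χ-same : ∀ {n} (v : Vec ℤ (suc n)) → χ v v ≡ 0ℤ
χ-same (x ∷ v) = trans (χ-∷ x x v v) (cong (_* χ v v) (χ₁-same x))

χ-meet : ∀ {n} {u v p : Vec ℤ n} → Meet u v p → χ u v ≡ 1ℤ
χ-meet []                                  = refl
χ-meet (_∷_ {x = x} {y} {u = u} {v} h t) =
  trans (χ-∷ x y u v) (cong₂ _*_ (χ₁-meet h) (χ-meet t))

-- The product vanishes as soon as one factor does; otherwise the intervals meet in a point in every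
-- coordinate.
χ-dichotomy : ∀ {n} (u v : Vec ℤ n) → χ u v ≡ 0ℤ ⊎ ∃ (Meet u v)
χ-dichotomy []      []      = inj₂ ([] , [])
χ-dichotomy (x ∷ u) (y ∷ v) with χ₁-dichotomy x y | χ-dichotomy u v
... | inj₂ (m , h) | inj₂ (p , t) = inj₂ (m ∷ p , h ∷ t)
... | inj₁ eq      | _            = inj₁ (trans (χ-∷ x y u v) (cong (_* χ u v) eq))
... | inj₂ _       | inj₁ eq      =
  inj₁ (trans (χ-∷ x y u v) (trans (cong (χ₁ x y *_) eq) (ℤₚ.*-zeroʳ (χ₁ x y))))

meet-≢ : ∀ {n} {u v p : Vec ℤ (suc n)} → Meet u v p → u ≢ v
meet-≢ {u = u} t refl = contradiction (trans (sym (χ-same u)) (χ-meet t)) λ ()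

-- Double counting over the voxels, the cells and the gaps

module _ {n} (V : List (Vec ℤ (suc n))) (E G : List (Box (suc n)))
  (V! : Uniqueₗ V) (E! : Uniqueₗ E) (G! : Uniqueₗ G)
  (E-sound : ∀ {e} → e ∈ₗ E → ∃[ v ] v ∈ₗ V × e ⊑ᵥ v)
  (E-complete : ∀ {e v} → v ∈ₗ V → e ⊑ᵥ v → e ∈ₗ E)
  (thin : ∀ {e u v w} → u ∈ₗ V → v ∈ₗ V → w ∈ₗ V →
    e ⊑ᵥ u → e ⊑ᵥ v → e ⊑ᵥ w → u ≢ v → u ≢ w → v ≢ w → ⊥)
  (G-sound : ∀ {g} → g ∈ₗ G → ∃[ a ] ∃[ b ] a ∈ₗ V × b ∈ₗ V × ∃ (Meet a b) ×
    g ⊑ᵥ a × g ⊑ᵥ b × (∀ {v} → v ∈ₗ V → g ⊑ᵥ v → v ≡ a ⊎ v ≡ b))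
  (G-complete : ∀ {u v p} → u ∈ₗ V → v ∈ₗ V → Meet u v p → Vec.map pt p ∈ₗ G)
  where

  -- By `only`, the indicator is nonzero at `a` and `b` alone, so the sum has two surviving terms.
  ∑-δ : ∀ {e a b} (f : Vec ℤ (suc n) → ℤ) → a ∈ₗ V → b ∈ₗ V → a ≢ b → e ⊑ᵥ a → e ⊑ᵥ b →
    (∀ {v} → v ∈ₗ V → e ⊑ᵥ v → v ≡ a ⊎ v ≡ b) → ∑ V (λ v → δ e v * f v) ≡ f a + f b
  ∑-δ {e} {a} {b} f a∈ b∈ a≢b e⊑a e⊑b only = begin
    ∑ V (λ v → δ e v * f v)                  ≡⟨ ∑-support _ V! ((a≢b ∷ []) ∷ [] ∷ [])
                                                 (λ { (here refl) → a∈ ; (there (here refl)) → b∈ })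
                                                 outside ⟩
    δ e a * f a + (δ e b * f b + 0ℤ)         ≡⟨ cong₂ (λ p q → p * f a + (q * f b + 0ℤ))
                                                 (𝟙-true (e ⊑ᵥ? a) e⊑a) (𝟙-true (e ⊑ᵥ? b) e⊑b) ⟩
    1ℤ * f a + (1ℤ * f b + 0ℤ)               ≡⟨ lemma (f a) (f b) ⟩
    f a + f b ∎
    where
    open ≡-Reasoning
    lemma : ∀ p q → 1ℤ * p + (1ℤ * q + 0ℤ) ≡ p + q
    lemma = solve-∀

    outside : ∀ {v} → v ∈ₗ V → v ∉ a ∷ b ∷ [] → δ e v * f v ≡ 0ℤ
    outside {v} v∈ v∉ = cong (_* f v) (𝟙-false (e ⊑ᵥ? v) λ e⊑v → v∉
      (case only v∈ e⊑v of λ { (inj₁ v≡a) → here v≡a ; (inj₂ v≡b) → there (here v≡b) }))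

  multiplicity : Box (suc n) → ℤ
  multiplicity e = ∑ V (δ e)

  -- `E-sound` supplies one voxel `a` around `e`, a search through `V` decides whether there is a
  -- second one, and `thin` excludes a third.
  multiplicity-≡1⊎≡2 : ∀ {e} → e ∈ₗ E → multiplicity e ≡ 1ℤ ⊎ multiplicity e ≡ + 2
  multiplicity-≡1⊎≡2 {e} e∈ with a , a∈ , e⊑a ← E-sound e∈
    with any? (λ v → ¬? (Vecₚ.≡-dec _≟_ v a) ×-dec e ⊑ᵥ? v) V
  ... | yes found
    with b , b∈ , b≢a , e⊑b ← find found = inj₂ (begin
      ∑ V (δ e)                ≡⟨ ∑-cong V (λ {v} _ → sym (ℤₚ.*-identityʳ (δ e v))) ⟩
      ∑ V (λ v → δ e v * 1ℤ)   ≡⟨ ∑-δ (λ _ → 1ℤ) a∈ b∈ (b≢a ∘ sym) e⊑a e⊑b only ⟩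
      + 2 ∎)
    where
    open ≡-Reasoning
    only : ∀ {v} → v ∈ₗ V → e ⊑ᵥ v → v ≡ a ⊎ v ≡ b
    only {v} v∈ e⊑v with Vecₚ.≡-dec _≟_ v a | Vecₚ.≡-dec _≟_ v b
    ... | yes v≡a | _       = inj₁ v≡a
    ... | no _    | yes v≡b = inj₂ v≡b
    ... | no v≢a  | no v≢b  =
      ⊥-elim (thin v∈ a∈ b∈ e⊑v e⊑a e⊑b v≢a v≢b (b≢a ∘ sym))
  ... | no none = inj₁ (begin
      ∑ V (δ e)      ≡⟨ ∑-support (δ e) V! ([] ∷ []) (λ { (here refl) → a∈ }) outside ⟩
      δ e a + 0ℤ     ≡⟨ cong (_+ 0ℤ) (𝟙-true (e ⊑ᵥ? a) e⊑a) ⟩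
      1ℤ ∎)
    where
    open ≡-Reasoning
    outside : ∀ {v} → v ∈ₗ V → v ∉ a ∷ [] → δ e v ≡ 0ℤ
    outside {v} v∈ v∉ = 𝟙-false (e ⊑ᵥ? v) λ e⊑v → none (lose v∈ (v∉ ∘ here , e⊑v))

  -- The factor `δ e u` restricts the sum to the faces of `u`, all of which belong to `E` by
  -- `E-complete`.
  ∑-δδ : ∀ {u} v → u ∈ₗ V → ∑ E (λ e → weight e * (δ e u * δ e v)) ≡ χ u v
  ∑-δδ {u} v u∈ = trans
    (∑-support _ E! (faces-unique u) (E-complete u∈ ∘ faces-sound u) outside)
    (∑-cong (faces u) inside)
    where
    outside : ∀ {e} → e ∈ₗ E → e ∉ faces u → weight e * (δ e u * δ e v) ≡ 0ℤ
    outside {e} _ e∉ = trans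
      (cong (λ d → weight e * (d * δ e v)) (𝟙-false (e ⊑ᵥ? u) (e∉ ∘ faces-complete)))
      (ℤₚ.*-zeroʳ (weight e))
    inside : ∀ {e} → e ∈ₗ faces u → weight e * (δ e u * δ e v) ≡ weight e * δ e v
    inside {e} e∈ = cong (weight e *_)
      (trans (cong (_* δ e v) (𝟙-true (e ⊑ᵥ? u) (faces-sound u e∈))) (ℤₚ.*-identityˡ _))

  ∑χ : ℤ
  ∑χ = ∑ V (λ u → ∑ V (χ u))

  -- Writing the indicator as its own square and exchanging the sums leaves the diagonal values
  -- `χ v v`, which are zero.
  ∑-multiplicity : ∑ E (λ e → weight e * multiplicity e) ≡ 0ℤ
  ∑-multiplicity = begin
    ∑ E (λ e → weight e * multiplicity e)
      ≡⟨ ∑-cong E (λ {e} _ → trans (*-distribˡ-∑ V (weight e) (δ e))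
           (∑-cong V (λ {v} _ → cong (weight e *_) (sym (δ-idem e v))))) ⟩
    ∑ E (λ e → ∑ V (λ v → weight e * (δ e v * δ e v)))
      ≡⟨ ∑-swap E V _ ⟩
    ∑ V (λ v → ∑ E (λ e → weight e * (δ e v * δ e v)))
      ≡⟨ ∑-cong V (λ {v} v∈ → trans (∑-δδ v v∈) (χ-same v)) ⟩
    ∑ V (λ _ → 0ℤ)
      ≡⟨ ∑-zero V ⟩
    0ℤ ∎
    where open ≡-Reasoning

  -- The squared multiplicity counts ordered pairs of voxels containing the cell; exchanging the
  -- sums groups the cells by pair.
  ∑-multiplicity² : ∑ E (λ e → weight e * (multiplicity e * multiplicity e)) ≡ ∑χ
  ∑-multiplicity² = begin
    ∑ E (λ e → weight e * (multiplicity e * multiplicity e))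
      ≡⟨ ∑-cong E (λ {e} _ → trans
           (cong (weight e *_) (trans (*-distribʳ-∑ V _ (δ e))
             (∑-cong V (λ {u} _ → *-distribˡ-∑ V (δ e u) (δ e)))))
           (trans (*-distribˡ-∑ V (weight e) _)
             (∑-cong V (λ _ → *-distribˡ-∑ V (weight e) _)))) ⟩
    ∑ E (λ e → ∑ V (λ u → ∑ V (λ v → weight e * (δ e u * δ e v))))
      ≡⟨ ∑-swap E V _ ⟩
    ∑ V (λ u → ∑ E (λ e → ∑ V (λ v → weight e * (δ e u * δ e v))))
      ≡⟨ ∑-cong V (λ {u} u∈ → trans (∑-swap E V _) (∑-cong V (λ {v} _ → ∑-δδ v u∈))) ⟩
    ∑χ ∎
    where open ≡-Reasoning

  -- A number n ∈ {1, 2} satisfies 2 = 3n − n².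
  2∑-weight : + 2 * ∑ E weight + ∑χ ≡ 0ℤ
  2∑-weight = begin
    + 2 * ∑ E weight + ∑χ
      ≡⟨ cong₂ _+_ (*-distribˡ-∑ E (+ 2) weight) (sym ∑-multiplicity²) ⟩
    ∑ E (λ e → + 2 * weight e) + ∑ E (λ e → weight e * (multiplicity e * multiplicity e))
      ≡⟨ ∑-+ E _ _ ⟨
    ∑ E (λ e → + 2 * weight e + weight e * (multiplicity e * multiplicity e))
      ≡⟨ ∑-cong E (λ {e} e∈ → pointwise (weight e) (multiplicity-≡1⊎≡2 e∈)) ⟩
    ∑ E (λ e → + 3 * (weight e * multiplicity e))
      ≡⟨ *-distribˡ-∑ E (+ 3) _ ⟨
    + 3 * ∑ E (λ e → weight e * multiplicity e)
      ≡⟨ cong (+ 3 *_) ∑-multiplicity ⟩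
    0ℤ ∎
    where
    open ≡-Reasoning
    lemma₁ : ∀ w → + 2 * w + w * (1ℤ * 1ℤ) ≡ + 3 * (w * 1ℤ)
    lemma₁ = solve-∀
    lemma₂ : ∀ w → + 2 * w + w * (+ 2 * + 2) ≡ + 3 * (w * + 2)
    lemma₂ = solve-∀
    pointwise : ∀ w {m} → m ≡ 1ℤ ⊎ m ≡ + 2 → + 2 * w + w * (m * m) ≡ + 3 * (w * m)
    pointwise w (inj₁ refl) = lemma₁ w
    pointwise w (inj₂ refl) = lemma₂ w

  -- If `u` and `v` meet in a point, that point is the one gap lying in both, so the factor is 1;
  -- otherwise `χ u v` is 0. This inserts a sum over the gaps into `∑χ`.
  ∑-gaps-at : ∀ {u v} → u ∈ₗ V → v ∈ₗ V → ∑ G (λ g → δ g u * δ g v) * χ u v ≡ χ u v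
  ∑-gaps-at {u} {v} u∈ v∈ with χ-dichotomy u v
  ... | inj₁ χ≡0       = trans (cong (∑ G (λ g → δ g u * δ g v) *_) χ≡0)
    (trans (ℤₚ.*-zeroʳ (∑ G (λ g → δ g u * δ g v))) (sym χ≡0))
  ... | inj₂ (p , u∩v) = trans (cong (_* χ u v) eq) (ℤₚ.*-identityˡ _)
    where
    g = Vec.map pt p
    outside : ∀ {h} → h ∈ₗ G → h ∉ g ∷ [] → δ h u * δ h v ≡ 0ℤ
    outside {h} _ h∉ with h ⊑ᵥ? u | h ⊑ᵥ? v
    ... | no _    | _       = refl
    ... | yes _   | no _    = refl
    ... | yes h⊑u | yes h⊑v = contradiction (here (meet-unique u∩v h⊑u h⊑v)) h∉
    eq : ∑ G (λ h → δ h u * δ h v) ≡ 1ℤ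
    eq = trans
      (∑-support _ G! ([] ∷ []) (λ { (here refl) → G-complete u∈ v∈ u∩v }) outside)
      (cong₂ (λ a b → a * b + 0ℤ) (𝟙-true (g ⊑ᵥ? u) (meet-⊑ u∩v))
                                  (𝟙-true (g ⊑ᵥ? v) (meet-⊑ (meet-sym u∩v))))

  -- Only `a` and `b` contain `g`. Among their four ordered pairs the two diagonal ones contribute 0
  -- and the two mixed ones 1.
  ∑-pairs-at : ∀ {g} → g ∈ₗ G → ∑ V (λ u → ∑ V (λ v → (δ g u * δ g v) * χ u v)) ≡ + 2
  ∑-pairs-at {g} g∈
    with a , b , a∈ , b∈ , (_ , a∩b) , g⊑a , g⊑b , only ← G-sound g∈ = begin
    ∑ V (λ u → ∑ V (λ v → (δ g u * δ g v) * χ u v))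
      ≡⟨ ∑-cong V (λ {u} _ → trans (∑-cong V (λ {v} _ → ℤₚ.*-assoc (δ g u) (δ g v) (χ u v)))
           (sym (*-distribˡ-∑ V (δ g u) _))) ⟩
    ∑ V (λ u → δ g u * ∑ V (λ v → δ g v * χ u v))
      ≡⟨ ∑-cong V (λ {u} _ → cong (δ g u *_) (∑-δ (χ u) a∈ b∈ a≢b g⊑a g⊑b only)) ⟩
    ∑ V (λ u → δ g u * (χ u a + χ u b))
      ≡⟨ ∑-δ (λ u → χ u a + χ u b) a∈ b∈ a≢b g⊑a g⊑b only ⟩
    (χ a a + χ a b) + (χ b a + χ b b)
      ≡⟨ cong₂ _+_ (cong₂ _+_ (χ-same a) (χ-meet a∩b))
                   (cong₂ _+_ (χ-meet (meet-sym a∩b)) (χ-same b)) ⟩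
    + 2 ∎
    where
    open ≡-Reasoning
    a≢b = meet-≢ a∩b

  ∑χ≡2*gaps : ∑χ ≡ + 2 * + length G
  ∑χ≡2*gaps = begin
    ∑ V (λ u → ∑ V (χ u))
      ≡⟨ ∑-cong V (λ {u} u∈ → ∑-cong V (λ {v} v∈ → trans (sym (∑-gaps-at u∈ v∈))
           (*-distribʳ-∑ G (χ u v) _))) ⟩
    ∑ V (λ u → ∑ V (λ v → ∑ G (λ g → (δ g u * δ g v) * χ u v)))
      ≡⟨ ∑-cong V (λ _ → ∑-swap V G _) ⟩
    ∑ V (λ u → ∑ G (λ g → ∑ V (λ v → (δ g u * δ g v) * χ u v)))
      ≡⟨ ∑-swap V G _ ⟩
    ∑ G (λ g → ∑ V (λ u → ∑ V (λ v → (δ g u * δ g v) * χ u v)))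
      ≡⟨ ∑-cong G ∑-pairs-at ⟩
    ∑ G (λ _ → + 2)
      ≡⟨ ∑-const G (+ 2) ⟩
    + 2 * + length G ∎
    where open ≡-Reasoning

  gaps≡-∑-weight : + length G ≡ - ∑ E weight
  gaps≡-∑-weight = ℤₚ.*-cancelˡ-≡ (+ 2) _ _ (begin
    + 2 * + length G                             ≡⟨ ∑χ≡2*gaps ⟨
    ∑χ                                           ≡⟨ lemma ∑χ (∑ E weight) ⟩
    (+ 2 * ∑ E weight + ∑χ) + + 2 * - ∑ E weight ≡⟨ cong (_+ + 2 * - ∑ E weight) 2∑-weight ⟩
    0ℤ + + 2 * - ∑ E weight                      ≡⟨ ℤₚ.+-identityˡ _ ⟩
    + 2 * - ∑ E weight ∎)
    where
    open ≡-Reasoning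
    lemma : ∀ x w → x ≡ (+ 2 * w + x) + + 2 * - w
    lemma = solve-∀

-- Cells as subsets of ℝ³

-- Undoes the shift by ½: `pt a` stands for the point `corner a`.
corner : ℤ → ℚ
corner a = fromℤ a ℚ.- ½

fromℤ+½≡corner : ∀ x → fromℤ x ℚ.+ ½ ≡ corner (sucℤ x)
-- Both sides unfold to a normalised fraction over 2; `lemma` compares the numerators as addition
-- produces them.
fromℤ+½≡corner x = cong (ℚ._/ 2) (lemma x)
  where
  lemma : ∀ x → x * + 2 + 1ℤ * 1ℤ ≡ (1ℤ + x) * + 2 + -1ℤ * 1ℤ
  lemma = solve-∀

corner-mono-< : ∀ {a b} → a ℤ.< b → corner a ℚ.< corner b
corner-mono-< {a} {b} a<b = ℚₚ.+-monoˡ-< (ℚ.- ½) {fromℤ a} {fromℤ b} (*<* (ℤₚ.*-monoʳ-<-pos 1ℤ a<b))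

corner-mono-≤ : ∀ {a b} → a ℤ.≤ b → corner a ℚ.≤ corner b
corner-mono-≤ {a} {b} a≤b with a ≟ b
... | yes refl = ℚₚ.≤-refl
... | no a≢b   = ℚₚ.<⇒≤ (corner-mono-< (ℤₚ.≤∧≢⇒< a≤b a≢b))

-- Rational points and closed intervals of Dedekind reals

fromℚ : ℚ → ℝ
fromℚ a = record
  { L           = ℚ._< a
  ; U           = a ℚ.<_
  ; L-inhabited = a ℚ.- ½ , subst (a ℚ.- ½ ℚ.<_) (ℚₚ.+-identityʳ a)
                              (ℚₚ.+-monoʳ-< a {ℚ.- ½} {ℚ.0ℚ} (*<* ℤ.-<+))
  ; U-inhabited = a ℚ.+ ½ , subst (ℚ._< a ℚ.+ ½) (ℚₚ.+-identityʳ a)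
                              (ℚₚ.+-monoʳ-< a {ℚ.0ℚ} {½} (*<* (ℤ.+<+ ℕ.z<s)))
  ; L-rounded   = λ q → mk⇔ ℚₚ.<-dense (λ (r , q<r , r<a) → ℚₚ.<-trans q<r r<a)
  ; U-rounded   = λ q → mk⇔ (λ a<q → let r , a<r , r<q = ℚₚ.<-dense a<q in r , r<q , a<r)
                            (λ (r , r<q , a<r) → ℚₚ.<-trans a<r r<q)
  ; disjoint    = λ q (q<a , a<q) → ℚₚ.<-asym q<a a<q
  ; located     = located
  }
  where
  located : ∀ {q r} → q ℚ.< r → q ℚ.< a ⊎ a ℚ.< r
  located {q} {r} q<r with ℚₚ.<-cmp q a
  ... | tri< q<a _ _ = inj₁ q<a
  ... | tri≈ _ q≡a _ = inj₂ (subst (ℚ._< r) q≡a q<r)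
  ... | tri> _ _ a<q = inj₂ (ℚₚ.<-trans a<q q<r)

-- Roundedness makes the upper cut closed upwards and the lower cut closed downwards, so widening
-- the bounds preserves the two negations.
[⋯]-mono : ∀ {a b c d} → c ℚ.≤ a → b ℚ.≤ d → [ a ⋯ b ] ⊆ [ c ⋯ d ]
[⋯]-mono {a} {b} {c} {d} c≤a b≤d {r} (¬U , ¬L) = ¬U ∘ raise , ¬L ∘ lower
  where
  open ℝ r
  raise : U c → U a
  raise Uc = let q , q<c , Uq = Equivalence.to (U-rounded c) Uc
             in Equivalence.from (U-rounded a) (q , ℚₚ.<-≤-trans q<c c≤a , Uq)
  lower : L d → L b
  lower Ld = let q , d<q , Lq = Equivalence.to (L-rounded d) Ld
             in Equivalence.from (L-rounded b) (q , ℚₚ.≤-<-trans b≤d d<q , Lq)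

lo hi : Interval → ℤ
lo (pt a)  = a
lo (seg a) = a
hi (pt a)  = a
hi (seg a) = sucℤ a

lo≤hi : ∀ k → lo k ℤ.≤ hi k
lo≤hi (pt a)  = ℤₚ.≤-refl
lo≤hi (seg a) = ℤₚ.i≤suc[i] a

extent : Interval → Pred ℝ 0ℓ
extent k = [ corner (lo k) ⋯ corner (hi k) ]

corner-∈⁺ : ∀ k {a} → lo k ℤ.≤ a → a ℤ.≤ hi k → extent k (fromℚ (corner a))
corner-∈⁺ k lo≤a a≤hi =
  (λ a<lo → ℚₚ.<-irrefl refl (ℚₚ.<-≤-trans a<lo (corner-mono-≤ lo≤a))) ,
  (λ hi<a → ℚₚ.<-irrefl refl (ℚₚ.<-≤-trans hi<a (corner-mono-≤ a≤hi)))

corner-∈⁻ : ∀ k {a} → extent k (fromℚ (corner a)) → lo k ℤ.≤ a × a ℤ.≤ hi k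
corner-∈⁻ k (¬a<lo , ¬hi<a) =
  ℤₚ.≮⇒≥ (¬a<lo ∘ corner-mono-<) , ℤₚ.≮⇒≥ (¬hi<a ∘ corner-mono-<)

1+i≰i : ∀ {i} → ¬ sucℤ i ℤ.≤ i
1+i≰i 1+i≤i = ℤₚ.<-irrefl refl (ℤₚ.suc[i]≤j⇒i<j 1+i≤i)

-- Integrality enters here: an integer between `b` and `sucℤ b` is one of the two, and a unit
-- segment fits into no point.
⊑⁺ : ∀ k k′ → lo k′ ℤ.≤ lo k → hi k ℤ.≤ hi k′ → k ⊑ k′
⊑⁺ (pt a)  (pt b)  b≤a a≤b     = ℤₚ.≤-antisym a≤b b≤a
⊑⁺ (seg a) (pt b)  b≤a 1+a≤b   = 1+i≰i (ℤₚ.≤-trans 1+a≤b b≤a)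
⊑⁺ (seg a) (seg b) b≤a 1+a≤1+b = ℤₚ.≤-antisym a≤b b≤a
  where a≤b = subst₂ ℤ._≤_ (ℤₚ.pred-suc a) (ℤₚ.pred-suc b) (ℤₚ.pred-mono 1+a≤1+b)
⊑⁺ (pt a)  (seg b) b≤a a≤1+b with a ≟ b
... | yes a≡b = inj₁ a≡b
... | no a≢b  = inj₂ (ℤₚ.≤-antisym a≤1+b (ℤₚ.i<j⇒suc[i]≤j (ℤₚ.≤∧≢⇒< b≤a (a≢b ∘ sym))))

⊑⁻ : ∀ k k′ → k ⊑ k′ → lo k′ ℤ.≤ lo k × hi k ℤ.≤ hi k′
⊑⁻ (pt a)  (pt .a)  refl        = ℤₚ.≤-refl , ℤₚ.≤-refl
⊑⁻ (pt a)  (seg .a) (inj₁ refl) = ℤₚ.≤-refl , ℤₚ.i≤suc[i] a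
⊑⁻ (pt _)  (seg b)  (inj₂ refl) = ℤₚ.i≤suc[i] b , ℤₚ.≤-refl
⊑⁻ (seg a) (seg .a) refl        = ℤₚ.≤-refl , ℤₚ.≤-refl

extent-mono : ∀ k k′ → k ⊑ k′ → extent k ⊆ extent k′
extent-mono k k′ k⊑k′ {r} =
  let lo≤ , ≤hi = ⊑⁻ k k′ k⊑k′ in [⋯]-mono (corner-mono-≤ lo≤) (corner-mono-≤ ≤hi) {r}

⊑-refl : ∀ k → k ⊑ k
⊑-refl (pt a)  = refl
⊑-refl (seg a) = refl

⊑-antisym : ∀ k k′ → k ⊑ k′ → k′ ⊑ k → k ≡ k′
⊑-antisym (pt a)  (pt b)  a≡b _ = cong pt a≡b
⊑-antisym (seg a) (seg b) a≡b _ = cong seg a≡b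

-- Canonical forms of cells

side : ℤ → Offset → Interval
side x -𝟏 = pt x
side x 𝟎  = seg x
side x +𝟏 = pt (sucℤ x)

interval≡extent : ∀ x θ → interval x θ ≡ extent (side x θ)
interval≡extent x -𝟏 = refl
interval≡extent x 𝟎  = cong [ corner x ⋯_] (fromℤ+½≡corner x)
interval≡extent x +𝟏 = cong (λ q → [ q ⋯ q ]) (fromℤ+½≡corner x)

-- An end point written with `+𝟏` at `x` or with `-𝟏` at `sucℤ x` receives the same `pt`. Hence
-- equality of cells as subsets becomes equality of keys, by `≡⇒≈` and `≈⇒≡`.
key : Cell → Box 3
key (cell x θ) = zipWith side x θ

interval≡extent-key : ∀ x θ j →
  interval (lookup x j) (lookup θ j) ≡ extent (lookup (key (cell x θ)) j)
interval≡extent-key x θ j =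
  trans (interval≡extent (lookup x j) (lookup θ j)) (cong extent (sym (lookup-zipWith side j x θ)))

⟦⟧⇒extent : ∀ e {p} → ⟦ e ⟧ p → ∀ j → extent (lookup (key e) j) (lookup p j)
⟦⟧⇒extent (cell x θ) {p} p∈e j = subst (λ P → P (lookup p j)) (interval≡extent-key x θ j) (p∈e j)

extent⇒⟦⟧ : ∀ e {p} → (∀ j → extent (lookup (key e) j) (lookup p j)) → ⟦ e ⟧ p
extent⇒⟦⟧ (cell x θ) {p} p∈e j =
  subst (λ P → P (lookup p j)) (sym (interval≡extent-key x θ j)) (p∈e j)

⊑⇒⊆ : ∀ e f → Pointwise _⊑_ (key e) (key f) → ⟦ e ⟧ ⊆ ⟦ f ⟧
⊑⇒⊆ e f e⊑f {p} p∈e = extent⇒⟦⟧ f {p} λ j →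
  extent-mono (lookup (key e) j) (lookup (key f) j) (Pointwise.lookup e⊑f j)
    {lookup p j} (⟦⟧⇒extent e {p} p∈e j)

-- The inclusion is tested on two vertices of `e`, the one with all lower ends and the one with all
-- upper ends. Their coordinates are corners, so membership in `f` amounts to integer inequalities.
⊆⇒⊑ : ∀ e f → ⟦ e ⟧ ⊆ ⟦ f ⟧ → Pointwise _⊑_ (key e) (key f)
⊆⇒⊑ e f e⊆f = extensional⇒inductive (ext λ j →
  ⊑⁺ (lookup (key e) j) (lookup (key f) j)
     (proj₁ (corner-∈⁻ (lookup (key f) j) (vertex lo (λ k → ℤₚ.≤-refl , lo≤hi k) j)))
     (proj₂ (corner-∈⁻ (lookup (key f) j) (vertex hi (λ k → lo≤hi k , ℤₚ.≤-refl) j))))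
  where
  vertex : (h : Interval → ℤ) → (∀ k → lo k ℤ.≤ h k × h k ℤ.≤ hi k) →
    ∀ j → extent (lookup (key f) j) (fromℚ (corner (h (lookup (key e) j))))
  vertex h bounds j = subst (extent (lookup (key f) j)) (lookup-p j)
    (⟦⟧⇒extent f {p} (e⊆f {p} (extent⇒⟦⟧ e {p} p∈e)) j)
    where
    p : Point
    p = Vec.map (fromℚ ∘ corner ∘ h) (key e)

    lookup-p : ∀ i → lookup p i ≡ fromℚ (corner (h (lookup (key e) i)))
    lookup-p i = lookup-map i (fromℚ ∘ corner ∘ h) (key e)

    p∈e : ∀ i → extent (lookup (key e) i) (lookup p i)
    p∈e i = let k = lookup (key e) i
                lo≤ , ≤hi = bounds k
            in subst (extent k) (sym (lookup-p i)) (corner-∈⁺ k lo≤ ≤hi)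

⊑-reflexive : ∀ {n} {k k′ : Box n} → k ≡ k′ → Pointwise _⊑_ k k′
⊑-reflexive refl = Pointwise.refl (λ {k} → ⊑-refl k)

pointwise-⊑-antisym : ∀ {n} {k k′ : Box n} → Pointwise _⊑_ k k′ → Pointwise _⊑_ k′ k → k ≡ k′
pointwise-⊑-antisym []        []        = refl
pointwise-⊑-antisym (p ∷ ps) (q ∷ qs) = cong₂ _∷_ (⊑-antisym _ _ p q) (pointwise-⊑-antisym ps qs)

≡⇒≈ : ∀ e f → key e ≡ key f → e ≈ f
≡⇒≈ e f eq = (λ {r} → ⊑⇒⊆ e f (⊑-reflexive eq) {r}) ,
             (λ {r} → ⊑⇒⊆ f e (⊑-reflexive (sym eq)) {r})

≈⇒≡ : ∀ e f → e ≈ f → key e ≡ key f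
≈⇒≡ e f (e⊆f , f⊆e) =
  pointwise-⊑-antisym (⊆⇒⊑ e f (λ {r} → e⊆f {r})) (⊆⇒⊑ f e (λ {r} → f⊆e {r}))

pointwise⇒⊑ᵥ : ∀ {n} {k : Box n} v → Pointwise _⊑_ k (Vec.map seg v) → k ⊑ᵥ v
pointwise⇒⊑ᵥ []      []       = []
pointwise⇒⊑ᵥ (x ∷ v) (p ∷ ps) = p ∷ pointwise⇒⊑ᵥ v ps

⊑ᵥ⇒pointwise : ∀ {n} {k : Box n} {v} → k ⊑ᵥ v → Pointwise _⊑_ k (Vec.map seg v)
⊑ᵥ⇒pointwise []       = []
⊑ᵥ⇒pointwise (p ∷ ps) = p ∷ ⊑ᵥ⇒pointwise ps

⊑-pts⇒≡ : ∀ {n} {k : Box n} p → Pointwise _⊑_ k (Vec.map pt p) → k ≡ Vec.map pt p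
⊑-pts⇒≡                []      []         = refl
⊑-pts⇒≡ {k = pt _ ∷ _} (m ∷ p) (a≡m ∷ ps) = cong₂ _∷_ (cong pt a≡m) (⊑-pts⇒≡ p ps)

⊑ᵥ-segs⇒≡ : ∀ {n} (u : Vec ℤ n) {v} → Vec.map seg u ⊑ᵥ v → u ≡ v
⊑ᵥ-segs⇒≡ []      []         = refl
⊑ᵥ-segs⇒≡ (x ∷ u) (x≡y ∷ ps) = cong₂ _∷_ x≡y (⊑ᵥ-segs⇒≡ u ps)

vertex-⊑ : ∀ {n} (k : Box n) → Pointwise _⊑_ (Vec.map pt (Vec.map lo k)) k
vertex-⊑ []          = []
vertex-⊑ (pt a ∷ k)  = refl ∷ vertex-⊑ k
vertex-⊑ (seg a ∷ k) = inj₁ refl ∷ vertex-⊑ k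

-- Dimension, voxels and vertices in terms of keys

rank : ∀ {n} → Box n → ℕ
rank []          = 0
rank (pt _ ∷ k)  = rank k
rank (seg _ ∷ k) = suc (rank k)

rank≤n : ∀ {n} (k : Box n) → rank k ℕ.≤ n
rank≤n []          = ℕ.z≤n
rank≤n (pt _ ∷ k)  = ℕₚ.m≤n⇒m≤1+n (rank≤n k)
rank≤n (seg _ ∷ k) = ℕ.s≤s (rank≤n k)

rank-pts : ∀ {n} (p : Vec ℤ n) → rank (Vec.map pt p) ≡ 0
rank-pts []      = refl
rank-pts (_ ∷ p) = rank-pts p

rank≡0⇒pts : ∀ {n} (k : Box n) → rank k ≡ 0 → k ≡ Vec.map pt (Vec.map lo k)
rank≡0⇒pts []         _  = refl
rank≡0⇒pts (pt a ∷ k) eq = cong (pt a ∷_) (rank≡0⇒pts k eq)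

rank≡n⇒segs : ∀ {n} (k : Box n) → rank k ≡ n → k ≡ Vec.map seg (Vec.map lo k)
rank≡n⇒segs []          _  = refl
rank≡n⇒segs (pt a ∷ k)  eq = contradiction (subst (ℕ._≤ _) eq (rank≤n k)) ℕₚ.1+n≰n
rank≡n⇒segs (seg a ∷ k) eq = cong (seg a ∷_) (rank≡n⇒segs k (ℕₚ.suc-injective eq))

weight≡-2^rank : ∀ {n} (k : Box n) → weight k ≡ -[1+ 1 ] ^ rank k
weight≡-2^rank []          = refl
weight≡-2^rank (pt _ ∷ k)  = trans (ℤₚ.*-identityˡ (weight k)) (weight≡-2^rank k)
weight≡-2^rank (seg _ ∷ k) = cong (-[1+ 1 ] *_) (weight≡-2^rank k)

dim≡rank : ∀ e → dim e ≡ rank (key e)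
dim≡rank (cell x θ) = count≡rank x θ
  where
  count≡rank : ∀ {n} (x : Vec ℤ n) θ → count (_≟ᴼ 𝟎) θ ≡ rank (zipWith side x θ)
  count≡rank []      []       = refl
  count≡rank (_ ∷ x) (-𝟏 ∷ θ) = count≡rank x θ
  count≡rank (_ ∷ x) (𝟎 ∷ θ)  = cong suc (count≡rank x θ)
  count≡rank (_ ∷ x) (+𝟏 ∷ θ) = count≡rank x θ

-- Of the two ways to write an end point the one with `-𝟏` is chosen, so that `lo` gives the
-- position for points and segments alike.
offset : Interval → Offset
offset (pt _)  = -𝟏
offset (seg _) = 𝟎

fromKey : Box 3 → Cell
fromKey k = cell (Vec.map lo k) (Vec.map offset k)

key-fromKey : ∀ k → key (fromKey k) ≡ k
key-fromKey = go
  where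
  go : ∀ {n} (k : Box n) → zipWith side (Vec.map lo k) (Vec.map offset k) ≡ k
  go []          = refl
  go (pt a ∷ k)  = cong (pt a ∷_) (go k)
  go (seg a ∷ k) = cong (seg a ∷_) (go k)

dim-fromKey : ∀ k → dim (fromKey k) ≡ rank k
dim-fromKey k = trans (dim≡rank (fromKey k)) (cong rank (key-fromKey k))

fromKey-⊆ : ∀ {k} e → Pointwise _⊑_ k (key e) → ⟦ fromKey k ⟧ ⊆ ⟦ e ⟧
fromKey-⊆ {k} e k⊑e {r} =
  ⊑⇒⊆ (fromKey k) e (subst (λ k → Pointwise _⊑_ k (key e)) (sym (key-fromKey k)) k⊑e) {r}

-- The key of a voxel consists of segments, and `lo (seg x)` is the midpoint `x` of the segment in
-- the unshifted coordinates.
centre : Cell → Vec ℤ 3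
centre v = Vec.map lo (key v)

voxel-key : ∀ v → IsVoxel v → key v ≡ Vec.map seg (centre v)
voxel-key v v-voxel = rank≡n⇒segs (key v) (trans (sym (dim≡rank v)) v-voxel)

vertex-key : ∀ e → IsCell 0 e → key e ≡ Vec.map pt (Vec.map lo (key e))
vertex-key e e-vertex = rank≡0⇒pts (key e) (trans (sym (dim≡rank e)) e-vertex)

⊆-voxel⁻ : ∀ e v → IsVoxel v → ⟦ e ⟧ ⊆ ⟦ v ⟧ → key e ⊑ᵥ centre v
⊆-voxel⁻ e v v-voxel e⊆v =
  pointwise⇒⊑ᵥ (centre v) (subst (Pointwise _⊑_ (key e)) (voxel-key v v-voxel)
    (⊆⇒⊑ e v (λ {r} → e⊆v {r})))

⊆-voxel⁺ : ∀ {k} v → IsVoxel v → k ⊑ᵥ centre v → ⟦ fromKey k ⟧ ⊆ ⟦ v ⟧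
⊆-voxel⁺ {k} v v-voxel k⊑ {r} =
  fromKey-⊆ v (subst (Pointwise _⊑_ k) (sym (voxel-key v v-voxel)) (⊑ᵥ⇒pointwise k⊑)) {r}

centre-injective : ∀ v w → IsVoxel v → IsVoxel w → centre v ≡ centre w → v ≈ w
centre-injective v w v-voxel w-voxel eq = ≡⇒≈ v w
  (trans (voxel-key v v-voxel) (trans (cong (Vec.map seg) eq) (sym (voxel-key w w-voxel))))

-- A unit segment lies in no other unit segment, so one voxel cannot lie properly in another. Hence
-- the 3-cells of an object are its voxels.
voxel-⊆⇒≈ : ∀ u v → IsVoxel u → IsVoxel v → ⟦ u ⟧ ⊆ ⟦ v ⟧ → u ≈ v
voxel-⊆⇒≈ u v u-voxel v-voxel u⊆v = centre-injective u v u-voxel v-voxel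
  (⊑ᵥ-segs⇒≡ (centre u) (subst (_⊑ᵥ centre v) (voxel-key u u-voxel)
    (⊆-voxel⁻ u v v-voxel (λ {r} → u⊆v {r}))))

≈-voxel : ∀ u v → u ≈ v → IsVoxel v → IsVoxel u
≈-voxel u v u≈v v-voxel = begin
  dim u        ≡⟨ dim≡rank u ⟩
  rank (key u) ≡⟨ cong rank (≈⇒≡ u v u≈v) ⟩
  rank (key v) ≡⟨ dim≡rank v ⟨
  dim v        ≡⟨ v-voxel ⟩
  3            ∎
  where open ≡-Reasoning

-- The lower end of the higher interval is the upper end of the lower one, and these two bounds pin
-- the point down.
extent-meet₁ : ∀ {x y m} → Meet₁ x y m → extent (seg x) ∩ extent (seg y) ⊆ extent (pt m)
extent-meet₁ (inj₁ (refl , refl)) ((¬Ux , _) , (_ , ¬L1+y)) = ¬Ux , ¬L1+y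
extent-meet₁ (inj₂ (refl , refl)) ((_ , ¬L1+x) , (¬Uy , _)) = ¬Uy , ¬L1+x

lookup-meet : ∀ {n} {u v p : Vec ℤ n} → Meet u v p →
  ∀ j → Meet₁ (lookup u j) (lookup v j) (lookup p j)
lookup-meet (h ∷ t) zero    = h
lookup-meet (h ∷ t) (suc j) = lookup-meet t j

extent-key : ∀ e (f : ℤ → Interval) v → key e ≡ Vec.map f v →
  ∀ j → extent (lookup (key e) j) ≡ extent (f (lookup v j))
extent-key e f v eq j = cong extent (trans (cong (λ k → lookup k j) eq) (lookup-map j f v))

meet-∩ : ∀ u v {p} → IsVoxel u → IsVoxel v → Meet (centre u) (centre v) p →
  ⟦ u ⟧ ∩ ⟦ v ⟧ ≐ ⟦ fromKey (Vec.map pt p) ⟧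
meet-∩ u v {p} u-voxel v-voxel u∩v =
  (λ {r} (r∈u , r∈v) → extent⇒⟦⟧ g {r} λ j →
    subst (λ P → P (lookup r j)) (sym (extent-key g pt p (key-fromKey (Vec.map pt p)) j))
      (extent-meet₁ (lookup-meet u∩v j) {lookup r j}
        (in-voxel u u-voxel {r} r∈u j , in-voxel v v-voxel {r} r∈v j))) ,
  (λ {r} r∈g → ⊆-voxel⁺ u u-voxel (meet-⊑ u∩v) {r} r∈g ,
               ⊆-voxel⁺ v v-voxel (meet-⊑ (meet-sym u∩v)) {r} r∈g)
  where
  g = fromKey (Vec.map pt p)

  in-voxel : ∀ v → IsVoxel v → ∀ {r} → ⟦ v ⟧ r →
    ∀ j → extent (seg (lookup (centre v) j)) (lookup r j)
  in-voxel v v-voxel {r} r∈v j =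
    subst (λ P → P (lookup r j)) (extent-key v seg (centre v) (voxel-key v v-voxel) j)
      (⟦⟧⇒extent v {r} r∈v j)

-- Enumerations by keys

Enumerates : ∀ {ℓ} → Pred Cell ℓ → List (Box 3) → Set ℓ
Enumerates P ks =
  Uniqueₗ ks × (∀ {e} → P e → key e ∈ₗ ks) × (∀ {k} → k ∈ₗ ks → ∃[ e ] P e × key e ≡ k)

-- Passing to keys replaces lists without repetition up to equality of subsets by lists without
-- repetition up to `≡`, to which the sums over lists apply.
enumerate : ∀ {ℓ} {P : Pred Cell ℓ} {n} → HasCardinality P n →
  ∃[ ks ] length ks ≡ n × Enumerates P ks
enumerate {P = P} (es , es! , (P⊆es , es⊆P) , refl) =
  map key es , length-map key es ,
  AllPairsₚ.map⁺ (AllPairs.map (λ {e} {f} e≉f eq → e≉f (≡⇒≈ e f eq)) es!) ,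
  (λ {e} Pe → Anyₚ.map⁺ (Any.map (λ {f} e≈f → ≈⇒≡ e f e≈f) (P⊆es Pe))) ,
  λ k∈ → let e , e∈es , k≡ = ∈-map⁻ key k∈
         in e , es⊆P (Any.map (Setoid.reflexive cellSetoid) e∈es) , sym k≡

-- Voxels, cells and gaps of a digital curve

module Curve (γ : DigitalObject) (curve : IsDigitalCurve γ)
  (ks : Fin 4 → List (Box 3)) (ks-enum : ∀ i → Enumerates (CellsOf (toℕ i) γ) (ks i))
  (G : List (Box 3)) (G-enum : Enumerates (Gaps₀ γ) G)
  where

  open IsDigitalCurve curve using (separated)

  γ-voxel : ∀ v → Voxels γ v → IsVoxel v
  γ-voxel v v∈γ with w , w∈ , v≈w ← find v∈γ =
    ≈-voxel v w v≈w (All.lookup (DigitalObject.voxels γ) w∈)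

  γ-resp-≈ : ∀ u v → u ≈ v → Voxels γ v → Voxels γ u
  γ-resp-≈ u v u≈v = Any.map (λ {w} → Setoid.trans cellSetoid {u} {v} {w} u≈v)

  -- Taken from the enumeration of the 3-cells, which has no repetitions, whereas `elements` may
  -- have some.
  V : List (Vec ℤ 3)
  V = map (Vec.map lo) (ks (# 3))

  3-cell⇒voxel : ∀ u → CellsOf 3 γ u → Voxels γ u
  3-cell⇒voxel u (u-voxel , v , v∈γ , u⊆v) =
    γ-resp-≈ u v (voxel-⊆⇒≈ u v u-voxel (γ-voxel v v∈γ) (λ {r} → u⊆v {r})) v∈γ

  V-complete : ∀ {v} → Voxels γ v → centre v ∈ₗ V
  V-complete {v} v∈γ =
    ∈-map⁺ (Vec.map lo) (proj₁ (proj₂ (ks-enum (# 3))) (γ-voxel v v∈γ , v , v∈γ , id))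

  V-sound : ∀ {x} → x ∈ₗ V → ∃[ v ] Voxels γ v × centre v ≡ x
  V-sound x∈ with k , k∈ , refl ← ∈-map⁻ (Vec.map lo) x∈
    with u , u-cell , refl ← proj₂ (proj₂ (ks-enum (# 3))) k∈ = u , 3-cell⇒voxel u u-cell , refl

  -- `Vec.map lo` is injective on keys of voxels, because there `Vec.map seg` inverts it.
  V! : Uniqueₗ V
  V! = unique-map (proj₁ (ks-enum (# 3))) (λ {k} k∈ →
    let u , (u-voxel , _) , eq = proj₂ (proj₂ (ks-enum (# 3))) k∈
    in subst (λ k → k ≡ Vec.map seg (Vec.map lo k)) eq (voxel-key u u-voxel))
    where
    unique-map : ∀ {ks} → Uniqueₗ ks → (∀ {k} → k ∈ₗ ks → k ≡ Vec.map seg (Vec.map lo k)) →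
      Uniqueₗ (map (Vec.map lo) ks)
    unique-map []              _  = []
    unique-map (k∉ks ∷ ks!) eq =
      Allₚ.map⁺ (All.tabulate λ {k′} k′∈ lo≡lo′ → All.lookup k∉ks k′∈
        (trans (eq (here refl)) (trans (cong (Vec.map seg) lo≡lo′) (sym (eq (there k′∈))))))
      ∷ unique-map ks! (eq ∘ there)

  E : List (Box 3)
  E = concat (tabulate ks)

  -- A key determines its rank, so the lists for different dimensions are disjoint.
  E! : Uniqueₗ E
  E! = concat⁺ (Allₚ.tabulate⁺ (λ i → proj₁ (ks-enum i)))
               (AllPairsₚ.tabulate⁺ λ {i} {j} i≢j (k∈i , k∈j) →
                 i≢j (toℕ-injective (disjoint i j k∈i k∈j)))
    where
    disjoint : ∀ i j {k} → k ∈ₗ ks i → k ∈ₗ ks j → toℕ i ≡ toℕ j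
    disjoint i j k∈i k∈j
      with e , (e-dim , _) , refl ← proj₂ (proj₂ (ks-enum i)) k∈i
         | f , (f-dim , _) , eq   ← proj₂ (proj₂ (ks-enum j)) k∈j = begin
      toℕ i        ≡⟨ e-dim ⟨
      dim e        ≡⟨ dim≡rank e ⟩
      rank (key e) ≡⟨ cong rank eq ⟨
      rank (key f) ≡⟨ dim≡rank f ⟨
      dim f        ≡⟨ f-dim ⟩
      toℕ j ∎
      where open ≡-Reasoning

  E-sound : ∀ {k} → k ∈ₗ E → ∃[ x ] x ∈ₗ V × k ⊑ᵥ x
  E-sound k∈ with _ , k∈i , i∈ ← ∈-concat⁻′ (tabulate ks) k∈
    with i , refl ← ∈-tabulate⁻ {f = ks} i∈
    with e , (_ , v , v∈γ , e⊆v) , refl ← proj₂ (proj₂ (ks-enum i)) k∈i =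
    centre v , V-complete v∈γ , ⊆-voxel⁻ e v (γ-voxel v v∈γ) (λ {r} → e⊆v {r})

  E-complete : ∀ {k x} → x ∈ₗ V → k ⊑ᵥ x → k ∈ₗ E
  E-complete {k} x∈ k⊑x with v , v∈γ , refl ← V-sound x∈ =
    ∈-concat⁺′ (subst (_∈ₗ ks i) (key-fromKey k) (proj₁ (proj₂ (ks-enum i))
                 (trans (dim-fromKey k) (sym (toℕ-fromℕ< rank<4)) ,
                  v , v∈γ , λ {r} → ⊆-voxel⁺ v (γ-voxel v v∈γ) k⊑x {r})))
               (∈-tabulate⁺ {f = ks} i)
    where
    -- A box with three coordinates has rank at most 3, so its rank selects one of the four lists.
    rank<4 = ℕ.s≤s (rank≤n k)
    i = fromℕ< rank<4

  -- Voxels with a common cell are pairwise 0-adjacent, so three distinct ones would contradict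
  -- `separated` at the first of them.
  thin : ∀ {k x y z} → x ∈ₗ V → y ∈ₗ V → z ∈ₗ V →
    k ⊑ᵥ x → k ⊑ᵥ y → k ⊑ᵥ z → x ≢ y → x ≢ z → y ≢ z → ⊥
  thin {k} x∈ y∈ z∈ k⊑x k⊑y k⊑z x≢y x≢z y≢z
    with u , u∈γ , refl ← V-sound x∈
       | v , v∈γ , refl ← V-sound y∈
       | w , w∈γ , refl ← V-sound z∈ =
    separated u v w u∈γ
      (v∈γ , adjacent v u v∈γ u∈γ k⊑y k⊑x (x≢y ∘ sym))
      (w∈γ , adjacent w u w∈γ u∈γ k⊑z k⊑x (x≢z ∘ sym))
      (≢⇒≉ v w y≢z) (adjacent v w v∈γ w∈γ k⊑y k⊑z y≢z)
    where
    ≢⇒≉ : ∀ v w → centre v ≢ centre w → v ≉ w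
    ≢⇒≉ v w v≢w v≈w = v≢w (cong (Vec.map lo) (≈⇒≡ v w v≈w))

    -- The lowest vertex of the common cell `k` is the 0-cell that witnesses each adjacency.
    p = fromKey (Vec.map pt (Vec.map lo k))

    p⊆ : ∀ v → Voxels γ v → k ⊑ᵥ centre v → ⟦ p ⟧ ⊆ ⟦ v ⟧
    p⊆ v v∈γ k⊑v {r} r∈p = ⊆-voxel⁺ v (γ-voxel v v∈γ) k⊑v {r}
      (fromKey-⊆ (fromKey k)
        (subst (Pointwise _⊑_ _) (sym (key-fromKey k)) (vertex-⊑ k)) {r} r∈p)

    adjacent : ∀ v w → Voxels γ v → Voxels γ w → k ⊑ᵥ centre v → k ⊑ᵥ centre w →
      centre v ≢ centre w → Adjacent 0 v w
    adjacent v w v∈γ w∈γ k⊑v k⊑w v≢w =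
      ≢⇒≉ v w v≢w , p , trans (dim-fromKey (Vec.map pt (Vec.map lo k))) (rank-pts (Vec.map lo k)) ,
      λ {r} r∈p → p⊆ v v∈γ k⊑v {r} r∈p , p⊆ w w∈γ k⊑w {r} r∈p

  G-sound : ∀ {g} → g ∈ₗ G → ∃[ a ] ∃[ b ] a ∈ₗ V × b ∈ₗ V × ∃ (Meet a b) ×
    g ⊑ᵥ a × g ⊑ᵥ b × (∀ {x} → x ∈ₗ V → g ⊑ᵥ x → x ≡ a ⊎ x ≡ b)
  G-sound g∈
    with e , (e-vertex , v , w , (P⊆ , ⊆P) , _ , (v∩w⊆e , _)) , refl ← proj₂ (proj₂ G-enum) g∈
    with v∈γ , v-voxel , e⊆v ← ⊆P {v} (inj₁ (Setoid.refl cellSetoid {v}))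
       | w∈γ , w-voxel , e⊆w ← ⊆P {w} (inj₂ (Setoid.refl cellSetoid {w})) =
    centre v , centre w , V-complete v∈γ , V-complete w∈γ ,
    (p , meet⁺ p (subst (_⊑ᵥ centre v) e≡p e⊑v) (subst (_⊑ᵥ centre w) e≡p e⊑w) ∩⇒≡) ,
    e⊑v , e⊑w , only
    where
    e⊑v = ⊆-voxel⁻ e v v-voxel (λ {r} → e⊆v {r})
    e⊑w = ⊆-voxel⁻ e w w-voxel (λ {r} → e⊆w {r})
    p = Vec.map lo (key e)
    e≡p = vertex-key e e-vertex

    -- A box inside both voxels lies in their intersection, hence in the vertex `e`, and a vertex
    -- contains no box but itself. This is the hypothesis `meet⁺` asks for.
    ∩⇒≡ : ∀ {k} → k ⊑ᵥ centre v → k ⊑ᵥ centre w → k ≡ Vec.map pt p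
    ∩⇒≡ {k} k⊑v k⊑w = ⊑-pts⇒≡ p
      (subst (Pointwise _⊑_ k) e≡p (subst (λ k → Pointwise _⊑_ k (key e)) (key-fromKey k)
        (⊆⇒⊑ (fromKey k) e λ {r} r∈k →
          v∩w⊆e {r} (⊆-voxel⁺ v v-voxel k⊑v {r} r∈k , ⊆-voxel⁺ w w-voxel k⊑w {r} r∈k))))

    only : ∀ {x} → x ∈ₗ V → key e ⊑ᵥ x → x ≡ centre v ⊎ x ≡ centre w
    only x∈ e⊑x with u , u∈γ , refl ← V-sound x∈ =
      Sum.map (cong (Vec.map lo) ∘ ≈⇒≡ u v) (cong (Vec.map lo) ∘ ≈⇒≡ u w)
        (P⊆ {u} (u∈γ , γ-voxel u u∈γ , λ {r} r∈e → ⊆-voxel⁺ u (γ-voxel u u∈γ) e⊑x {r}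
          (⊑⇒⊆ e (fromKey (key e)) (⊑-reflexive (sym (key-fromKey (key e)))) {r} r∈e)))

  -- The intersection of the two voxels is the vertex `g` by `meet-∩`. A further voxel of the curve
  -- around `g` is impossible by `thin`, so the two form the whole tandem.
  G-complete : ∀ {x y p} → x ∈ₗ V → y ∈ₗ V → Meet x y p → Vec.map pt p ∈ₗ G
  G-complete {p = p} x∈ y∈ x∩y
    with u , u∈γ , refl ← V-sound x∈
       | v , v∈γ , refl ← V-sound y∈ =
    subst (_∈ₗ G) (key-fromKey (Vec.map pt p)) (proj₁ (proj₂ G-enum)
      (g-vertex , u , v , ((λ {w} → only {w}) , (λ {w} → both {w})) ,
       (u≉v , g , g-vertex , u∩v≐g) , u∩v≐g))
    where
    g = fromKey (Vec.map pt p)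
    g-vertex = trans (dim-fromKey (Vec.map pt p)) (rank-pts p)
    u∩v≐g = meet-∩ u v (γ-voxel u u∈γ) (γ-voxel v v∈γ) x∩y

    u≉v : u ≉ v
    u≉v u≈v = meet-≢ x∩y (cong (Vec.map lo) (≈⇒≡ u v u≈v))

    only : (Voxels γ ∩ Block₀ g) ⊆ ｛ u , v ｝
    only {w} (w∈γ , w-voxel , g⊆w)
      with Vecₚ.≡-dec _≟_ (centre w) (centre u) | Vecₚ.≡-dec _≟_ (centre w) (centre v)
    ... | yes w≡u | _       = inj₁ (centre-injective w u w-voxel (γ-voxel u u∈γ) w≡u)
    ... | no _    | yes w≡v = inj₂ (centre-injective w v w-voxel (γ-voxel v v∈γ) w≡v)
    ... | no w≢u  | no w≢v  = ⊥-elim (thin (V-complete w∈γ) x∈ y∈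
      (subst (_⊑ᵥ centre w) (key-fromKey (Vec.map pt p)) (⊆-voxel⁻ g w w-voxel (λ {r} → g⊆w {r})))
      (meet-⊑ x∩y) (meet-⊑ (meet-sym x∩y)) w≢u w≢v (meet-≢ x∩y))

    both : ｛ u , v ｝ ⊆ (Voxels γ ∩ Block₀ g)
    both {w} (inj₁ w≈u) = γ-resp-≈ w u w≈u u∈γ , ≈-voxel w u w≈u (γ-voxel u u∈γ) ,
      λ {r} r∈g → proj₂ w≈u {r} (proj₁ (proj₂ u∩v≐g {r} r∈g))
    both {w} (inj₂ w≈v) = γ-resp-≈ w v w≈v v∈γ , ≈-voxel w v w≈v (γ-voxel v v∈γ) ,
      λ {r} r∈g → proj₂ w≈v {r} (proj₂ (proj₂ u∩v≐g {r} r∈g))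

  gaps : + length G ≡ - ∑ E weight
  gaps = gaps≡-∑-weight V E G V! E! (proj₁ G-enum) E-sound E-complete thin G-sound G-complete

-- From weights to the numbers of cells

-- The weight is constant on cells of dimension `i`, with value (-2)^i.
∑-weight-enumerated : ∀ {i γ n ks} → length ks ≡ n → Enumerates (CellsOf i γ) ks →
  ∑ ks weight ≡ -[1+ 1 ] ^ i * + n
∑-weight-enumerated {i} {ks = ks} refl (_ , _ , sound) = trans
  (∑-cong ks λ {k} k∈ → let e , (e-dim , _) , eq = sound k∈ in
    trans (weight≡-2^rank k)
      (cong (-[1+ 1 ] ^_) (trans (cong rank (sym eq)) (trans (sym (dim≡rank e)) e-dim))))
  (∑-const ks (-[1+ 1 ] ^ i))

theorem1 : (γ : DigitalObject) → IsDigitalCurve γ →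
    (c : Fin 4 → ℕ) → (∀ i → HasCardinality (CellsOf (toℕ i) γ) (c i)) →
    (g₀ : ℕ) → HasCardinality (Gaps₀ γ) g₀ →
    + g₀ ≡ ∑[ i < 4 ] (-1ℤ ^ suc (toℕ i) * (+ 2) ^ toℕ i * + c i)
theorem1 γ curve c c-card g₀ g₀-card
  with G , refl , G-enum ← enumerate g₀-card = begin
  + length G
    ≡⟨ Curve.gaps γ curve ks (proj₂ ∘ proj₂ ∘ cells) G G-enum ⟩
  - ∑ (concat (tabulate ks)) weight
    ≡⟨ cong -_ (trans (∑-++ (ks (# 0)) _ weight) (cong₂ _+_ (∑≡ (# 0))
         (trans (∑-++ (ks (# 1)) _ weight) (cong₂ _+_ (∑≡ (# 1))
           (trans (∑-++ (ks (# 2)) _ weight) (cong₂ _+_ (∑≡ (# 2))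
             (trans (∑-++ (ks (# 3)) [] weight) (cong₂ _+_ (∑≡ (# 3)) refl)))))))) ⟩
  - (1ℤ * + c (# 0) + (-[1+ 1 ] * + c (# 1) + (+ 4 * + c (# 2) + (-[1+ 7 ] * + c (# 3) + 0ℤ))))
    ≡⟨ signs (+ c (# 0)) (+ c (# 1)) (+ c (# 2)) (+ c (# 3)) ⟩
  ∑[ i < 4 ] (-1ℤ ^ suc (toℕ i) * (+ 2) ^ toℕ i * + c i) ∎
  where
  open ≡-Reasoning
  cells = λ i → enumerate (c-card i)
  ks = proj₁ ∘ cells

  ∑≡ : ∀ i → ∑ (ks i) weight ≡ -[1+ 1 ] ^ toℕ i * + c i
  ∑≡ i = ∑-weight-enumerated {γ = γ} (proj₁ (proj₂ (cells i))) (proj₂ (proj₂ (cells i)))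

  -- The coefficients -1, 2, -4, 8 on the right are the values of (-1)^(i+1) 2^i, that is -(-2)^i,
  -- and the trailing `0ℤ` matches the end of the unfolded finite sum.
  signs : ∀ a b c d → - (1ℤ * a + (-[1+ 1 ] * b + (+ 4 * c + (-[1+ 7 ] * d + 0ℤ))))
    ≡ -1ℤ * a + (+ 2 * b + (-[1+ 3 ] * c + (+ 8 * d + 0ℤ)))
  signs = solve-∀
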